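{- For any integer $k\ge 2$ and any fixed graph $G$ with $\chi(G)\ge k+1$, $$\hat{\pi}_k(G)=1-\frac{1}{\chi(G)-1}.$$
   Context: A $k$-graph is a hypergraph all of whose edges have exactly $k$ vertices. The shadow $\partial(\mathcal{H})$ of a hypergraph $\mathcal{H}$ is the simple graph on $V(\mathcal{H})$ in which $uv$ is an edge iff $\{u,v\}\subseteq h$ for some edge $h$ of $\mathcal{H}$. For a simple graph $G$, a hypergraph $\mathcal{H}$ is a Berge-$G$ if there is an injection $i:V(G)\to V(\mathcal{H})$ and a bijection $f:E(G)\to E(\mathcal{H})$ with $\{i(u),i(v)\}\subseteq f(uv)$ for every $uv\in E(G)$; $\mathcal{H}$ is Berge-$G$-free if no subhypergraph of it is a Berge-$G$. $\hat{\mathrm{ex}}_k(n,G)$ is the maximum number of edges of $\partial(\mathcal{H})$ over all Berge-$G$-free $k$-graphs $\mathcal{H}$ on $n$ vertices, and the cover Turán density is $\hat{\pi}_k(G)=\limsup_{n\to\infty}\hat{\mathrm{ex}}_k(n,G)/\binom{n}{2}$. $\chi(G)$ is the chromatic number. -}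

module Defs where

open import Data.Nat using (ℕ; zero; suc; _<?_; _≥_)
open import Data.Nat.Combinatorics using (_C_)
open import Data.Fin using (Fin; toℕ)
open import Data.Fin.Subset using (Subset; _∈_; ∣_∣)
open import Data.Fin.Subset.Properties using (_∈?_)
open import Data.Fin.Properties using (any?)
open import Data.List using (List; map; allFin)
open import Data.Nat.ListAction using (sum)
open import Data.Product using (Σ; _×_; _,_; ∃)
open import Data.Sum using (_⊎_)
open import Data.Integer using (+_)
open import Data.Rational using (ℚ; _/_; 0ℚ; 1ℚ; _+_; _-_; _*_; _≤_; Positive)
open import Relation.Nullary using (¬_; does)
open import Relation.Nullary.Decidable using (_×-dec_)
open import Relation.Binary.PropositionalEquality using (_≡_; _≢_)
open import Function.Definitions using (Injective)
open import Data.Bool using (if_then_else_)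

record Graph : Set where
  field
    nv ne : ℕ
    src tgt : Fin ne → Fin nv
    loopless : ∀ j → src j ≢ tgt j
    simple : ∀ j j' → ((src j ≡ src j' × tgt j ≡ tgt j') ⊎ (src j ≡ tgt j' × tgt j ≡ src j')) → j ≡ j'
open Graph public

record KGraph (k n : ℕ) : Set where
  field
    size : ℕ
    edge : Fin size → Subset n
    edge-inj : Injective _≡_ _≡_ edge
    uniform : ∀ j → ∣ edge j ∣ ≡ k
open KGraph public

-- H contains a Berge-G as a subhypergraph: an injection of vertices i and an
-- injection f of E(G) into E(H) (a bijection onto the subhypergraph f(E(G)))
-- with {i(u), i(v)} ⊆ f(uv).
BergeCopy : ∀ {k n} → Graph → KGraph k n → Set
BergeCopy {k} {n} G H =
  Σ (Fin (nv G) → Fin n) λ i → Injective _≡_ _≡_ i ×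
  Σ (Fin (ne G) → Fin (size H)) λ f → Injective _≡_ _≡_ f ×
  (∀ j → (i (src G j) ∈ edge H (f j)) × (i (tgt G j) ∈ edge H (f j)))

BergeFree : ∀ {k n} → Graph → KGraph k n → Set
BergeFree G H = ¬ BergeCopy G H

shadowSize : ∀ {k n} → KGraph k n → ℕ
shadowSize {k} {n} H = sum (map (λ u → sum (map (λ v →
  if does ((toℕ u <? toℕ v) ×-dec any? (λ j → (u ∈? edge H j) ×-dec (v ∈? edge H j)))
  then 1 else 0) (allFin n))) (allFin n))

ℕtoℚ : ℕ → ℚ
ℕtoℚ m = (+ m) / 1

-- 1/d as a rational (d = 0 mapped to 0; only used with d ≥ 2).
inv : ℕ → ℚ
inv zero = 0ℚ
inv (suc d) = (+ 1) / suc d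

Colorable : Graph → ℕ → Set
Colorable G c = Σ (Fin (nv G) → Fin c) λ col → ∀ j → col (src G j) ≢ col (tgt G j)

IsChromaticNumber : Graph → ℕ → Set
IsChromaticNumber G χ = Colorable G χ × (∀ c → c Data.Nat.< χ → ¬ Colorable G c)

-- The cover Turán density π̂_k(G) equals r:
-- limsup_{n→∞} ex̂_k(n,G) / C(n,2) = r, where ex̂_k(n,G) is the max shadow size
-- over Berge-G-free k-graphs on n vertices, unfolded as
--  (upper) ∀ε>0 ∃N ∀n≥N: every Berge-G-free k-graph on n vertices has shadow ≤ (r+ε)C(n,2);
--  (lower) ∀ε>0 ∀N ∃n≥N: some Berge-G-free k-graph on n vertices has shadow ≥ (r-ε)C(n,2).
CoverDensityIs : ℕ → Graph → ℚ → Set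
CoverDensityIs k G r =
  (∀ (ε : ℚ) → Positive ε → ∃ λ N → ∀ n → n ≥ N → (H : KGraph k n) → BergeFree G H →
      ℕtoℚ (shadowSize H) ≤ (r + ε) * ℕtoℚ (n C 2))
  × (∀ (ε : ℚ) → Positive ε → ∀ N → ∃ λ n → n ≥ N × Σ (KGraph k n) λ H → BergeFree G H ×
      ((r - ε) * ℕtoℚ (n C 2) ≤ ℕtoℚ (shadowSize H)))

{-# OPTIONS --safe #-}
-- Put r = χ(G) − 1.
--
-- Upper bound.  A shadow with more than (1 − 1/r + ε) C(n,2) edges contains, by Erdős–Stone, a complete
-- χ(G)-partite graph with huge parts.  Fix for each of its edges uv one hyperedge f(uv) ⊇ {u, v}.  As
-- |f(uv)| = k is bounded, a greedy choice gives a copy of G in which no vertex w lies in f(uv) for two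
-- other vertices u, v of the copy.  Then f(uv) meets the copy in {u, v} only, so f is injective on the edges
-- of the copy, which is therefore a Berge-G.
--
-- Lower bound.  Take all k-sets meeting each of r equal parts in at most one vertex.  Because k ≤ r, their
-- shadow is the complete r-partite graph, and a Berge-G would yield an r-colouring of G.
module Submission where

open import Defs
open import Data.Bool using (Bool; true; false; not; _∧_; if_then_else_)
import Data.Bool.Properties as Bool
open import Data.Empty using (⊥-elim)
open import Data.Fin using (Fin; zero; suc; toℕ; quotient; remainder; combine)
import Data.Fin.Properties as Fin
open import Data.Fin.Subset as Subset using (Subset; inside; outside; ∣_∣)
open import Data.Fin.Subset.Properties using (_∈?_; x∈⁅x⁆; x∈⁅y⁆⇒x≡y; ∣⁅x⁆∣≡1)
open import Data.Integer as ℤ using (+[1+_])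
import Data.Integer.Properties as ℤ
open import Data.List using (List; []; _∷_; _++_; map; length; lookup; filter; take; concatMap; allFin)
open import Data.List.Membership.Propositional using (_∈_; _∉_; find)
open import Data.List.Membership.Propositional.Properties
  using (∈-∃++; ∈-filter⁺; ∈-filter⁻; ∈-allFin; ∈-++⁺ˡ; ∈-++⁺ʳ; ∈-concatMap⁺; ∈-concatMap⁻; ∈-map⁺; ∈-map⁻; ∈-lookup)
open import Data.List.Properties using (length-take; length-++; length-tabulate; length-map; map-++)
open import Data.List.Relation.Binary.Permutation.Propositional using (_↭_; ↭⇒↭ₛ)
open import Data.List.Relation.Binary.Permutation.Propositional.Properties using (map⁺; shift; ↭-length; ∈-resp-↭)
import Data.List.Relation.Binary.Permutation.Setoid.Properties as ↭ₛ
open import Data.List.Relation.Unary.All as All using ([]; _∷_)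
open import Data.List.Relation.Unary.All.Properties using (¬All⇒Any¬)
open import Data.List.Relation.Unary.AllPairs using ([]; _∷_)
open import Data.List.Relation.Unary.Any as Any using (here; there)
open import Data.List.Relation.Unary.Any.Properties using (lookup-index)
open import Data.List.Relation.Unary.Unique.Propositional using (Unique)
import Data.List.Relation.Unary.Unique.Propositional.Properties as Unique
open import Data.Nat using (ℕ; zero; suc; _+_; _*_; _^_; _∸_; _≤_; _<_; _≥_; z≤n; s≤s; _≤?_; _<?_; NonZero; >-nonZero)
open import Data.Nat.Combinatorics using (_C_; nC1≡n; nCk+nC[k+1]≡[n+1]C[k+1])
open import Data.Nat.ListAction using (sum)
open import Data.Nat.ListAction.Properties using (sum-↭; sum-++)
open import Data.Nat.Properties
open import Data.Nat.Tactic.RingSolver using (solve-∀)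
open import Data.Product using (Σ; ∃; _×_; _,_; proj₁; proj₂)
open import Data.Rational as ℚ using (ℚ; mkℚ; 1ℚ; _-_; toℚᵘ)
import Data.Rational.Properties as ℚ
open import Data.Rational.Solver using (module +-*-Solver)
open import Data.Rational.Unnormalised as ℚᵘ using (mkℚᵘ; *≡*; *≤*)
import Data.Rational.Unnormalised.Properties as ℚᵘ
open import Data.Sum using (_⊎_; inj₁; inj₂)
open import Data.Vec using ([]; _∷_; here; there; _[_]≔_)
open import Data.Vec.Properties using ([]≔-updates; []≔-minimal; ∷-injectiveʳ)
open import Function using (_∘_; case_of_)
open import Function.Bundles using (mk⇔)
open import Function.Definitions using (Injective)
open import Relation.Binary.Definitions using (DecidableEquality; tri<; tri≈; tri>)
open import Relation.Binary.PropositionalEquality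
open import Relation.Nullary using (¬_; Dec; yes; no; does; contradiction)
open import Relation.Nullary.Decidable using (¬?; _×-dec_; _→-dec_; does-⇔; dec-true; dec-false)
open import Relation.Unary using (Decidable)

-- Finite sums and lists without repetitions.

private variable
  X Y : Set

∑ : List X → (X → ℕ) → ℕ
∑ xs f = sum (map f xs)

ind : Bool → ℕ
ind b = if b then 1 else 0

∑-cong : ∀ (xs : List X) {f g : X → ℕ} → (∀ x → f x ≡ g x) → ∑ xs f ≡ ∑ xs g
∑-cong []       eq = refl
∑-cong (x ∷ xs) eq = cong₂ _+_ (eq x) (∑-cong xs eq)

∑-mono : ∀ (xs : List X) {f g : X → ℕ} → (∀ {x} → x ∈ xs → f x ≤ g x) → ∑ xs f ≤ ∑ xs g
∑-mono []       le = z≤n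
∑-mono (x ∷ xs) le = +-mono-≤ (le (here refl)) (∑-mono xs (le ∘ there))

∑-const : ∀ (xs : List X) c → ∑ xs (λ _ → c) ≡ length xs * c
∑-const []       c = refl
∑-const (x ∷ xs) c = cong (c +_) (∑-const xs c)

∑-+ : ∀ (xs : List X) (f g : X → ℕ) → ∑ xs (λ x → f x + g x) ≡ ∑ xs f + ∑ xs g
∑-+ []       f g = refl
∑-+ (x ∷ xs) f g = trans (cong (f x + g x +_) (∑-+ xs f g)) (interchange (f x) (g x) (∑ xs f) (∑ xs g))
  where
  interchange : ∀ a b c d → a + b + (c + d) ≡ a + c + (b + d)
  interchange = solve-∀

∑-*ˡ : ∀ c (xs : List X) (f : X → ℕ) → ∑ xs (λ x → c * f x) ≡ c * ∑ xs f
∑-*ˡ c []       f = sym (*-zeroʳ c)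
∑-*ˡ c (x ∷ xs) f = trans (cong (c * f x +_) (∑-*ˡ c xs f)) (sym (*-distribˡ-+ c (f x) _))

∑-swap : ∀ (xs : List X) (ys : List Y) (f : X → Y → ℕ) →
  ∑ xs (λ x → ∑ ys (f x)) ≡ ∑ ys (λ y → ∑ xs (λ x → f x y))
∑-swap []       ys f = sym (trans (∑-const ys 0) (*-zeroʳ (length ys)))
∑-swap (x ∷ xs) ys f = trans (cong (∑ ys (f x) +_) (∑-swap xs ys f)) (sym (∑-+ ys (f x) _))

∑-concatMap : ∀ (g : X → List Y) (xs : List X) (f : Y → ℕ) → ∑ (concatMap g xs) f ≡ ∑ xs (λ x → ∑ (g x) f)
∑-concatMap g []       f = refl
∑-concatMap g (x ∷ xs) f = begin
  sum (map f (g x ++ concatMap g xs))            ≡⟨ cong sum (map-++ f (g x) _) ⟩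
  sum (map f (g x) ++ map f (concatMap g xs))    ≡⟨ sum-++ (map f (g x)) _ ⟩
  ∑ (g x) f + ∑ (concatMap g xs) f               ≡⟨ cong (∑ (g x) f +_) (∑-concatMap g xs f) ⟩
  ∑ (g x) f + ∑ xs (λ x → ∑ (g x) f)             ∎
  where open ≡-Reasoning

∑-↭ : ∀ {xs ys : List X} (f : X → ℕ) → xs ↭ ys → ∑ xs f ≡ ∑ ys f
∑-↭ f p = sum-↭ (map⁺ f p)

∈⇒≤∑ : ∀ {xs : List X} (f : X → ℕ) {x} → x ∈ xs → f x ≤ ∑ xs f
∈⇒≤∑ {xs = _ ∷ xs} f (here refl) = m≤m+n _ _
∈⇒≤∑ {xs = y ∷ xs} f (there p)   = ≤-trans (∈⇒≤∑ f p) (m≤n+m _ (f y))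

length-concatMap : ∀ (g : X → List Y) (xs : List X) → length (concatMap g xs) ≡ ∑ xs (length ∘ g)
length-concatMap g []       = refl
length-concatMap g (x ∷ xs) = trans (length-++ (g x)) (cong (length (g x) +_) (length-concatMap g xs))

length-concatMap-const : ∀ (g : X → List Y) (xs : List X) {c} → (∀ x → length (g x) ≡ c) →
  length (concatMap g xs) ≡ length xs * c
length-concatMap-const g xs eq = trans (length-concatMap g xs) (trans (∑-cong xs eq) (∑-const xs _))

length-concatMap-≤ : ∀ (g : X → List Y) (xs : List X) {c} → (∀ x → length (g x) ≤ c) →
  length (concatMap g xs) ≤ length xs * c
length-concatMap-≤ g xs le = begin
  length (concatMap g xs)   ≡⟨ length-concatMap g xs ⟩
  ∑ xs (length ∘ g)         ≤⟨ ∑-mono xs (λ {x} _ → le x) ⟩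
  ∑ xs (λ _ → _)            ≡⟨ ∑-const xs _ ⟩
  length xs * _             ∎
  where open ≤-Reasoning

length-filter-¬ : ∀ {P : X → Set} (P? : Decidable P) xs →
  length (filter P? xs) + ∑ xs (λ x → ind (not (does (P? x)))) ≡ length xs
length-filter-¬ P? []       = refl
length-filter-¬ P? (x ∷ xs) with does (P? x)
... | true  = cong suc (length-filter-¬ P? xs)
... | false = trans (+-suc _ _) (cong suc (length-filter-¬ P? xs))

length-filter : ∀ {P : X → Set} (P? : Decidable P) xs →
  length (filter P? xs) ≡ ∑ xs (λ x → ind (does (P? x)))
length-filter P? []       = refl
length-filter P? (x ∷ xs) with does (P? x)
... | true  = cong suc (length-filter P? xs)
... | false = length-filter P? xs

length-allFin : ∀ n → length (allFin n) ≡ n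
length-allFin n = length-tabulate {n = n} (λ i → i)

∈-take : ∀ n (xs : List X) {x} → x ∈ take n xs → x ∈ xs
∈-take (suc n) (y ∷ xs) (here eq) = here eq
∈-take (suc n) (y ∷ xs) (there p) = there (∈-take n xs p)

∈⇒↭ : ∀ {x} {xs : List X} → x ∈ xs → ∃ λ ys → xs ↭ x ∷ ys
∈⇒↭ p with ys , zs , refl ← ∈-∃++ p = ys ++ zs , shift _ ys zs

Unique-resp-↭ : ∀ {xs ys : List X} → xs ↭ ys → Unique xs → Unique ys
Unique-resp-↭ {X} p = ↭ₛ.Unique-resp-↭ (setoid X) (↭⇒↭ₛ p)

Unique-⊆-length : ∀ {xs ys : List X} → Unique xs → (∀ {x} → x ∈ xs → x ∈ ys) → length xs ≤ length ys
Unique-⊆-length {xs = []}     _         _   = z≤n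
Unique-⊆-length {xs = x ∷ xs} (x∉ ∷ ux) sub with ∈⇒↭ (sub (here refl))
... | zs , p = subst (suc (length xs) ≤_) (sym (↭-length p)) (s≤s (Unique-⊆-length ux sub′))
  where
  sub′ : ∀ {y} → y ∈ xs → y ∈ zs
  sub′ y∈ with ∈-resp-↭ p (sub (there y∈))
  ... | here refl = ⊥-elim (All.lookup x∉ y∈ refl)
  ... | there q   = q

-- Pigeonhole: if every entry of `xs` were bad, the repetition-free `xs` would be no longer than
-- `bad`. Both greedy constructions, of the Berge copy and of the transversal edges, choose their
-- next element this way.
∃-avoiding : DecidableEquality X → ∀ (xs bad : List X) → Unique xs → length bad < length xs →
  ∃ λ x → x ∈ xs × x ∉ bad
∃-avoiding {X} _≟_ xs bad ux lt with All.all? (λ x → Any.any? (x ≟_) bad) xs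
... | yes all = contradiction (Unique-⊆-length ux (All.lookup all)) (<⇒≱ lt)
... | no ¬all = find (¬All⇒Any¬ (λ x → Any.any? (x ≟_) bad) xs ¬all)

-- The Erdős–Stone theorem

-- The first summand secures a blow-up with one class fewer, whose classes have size
-- `(2 + q) * suc t`; the second is what `addClass` needs to gain a class while the old classes
-- shrink to `t`.
blowupThreshold : (r q t : ℕ) → ℕ
blowupThreshold zero    q t = t
blowupThreshold (suc r) q t =
  blowupThreshold r q ((2 + q) * suc t) + suc q * suc q * (2 ^ (suc r * ((2 + q) * suc t)) * suc t)

module Adjacency {X : Set} (e : X → X → Bool) (e-sym : ∀ u v → e u v ≡ e v u) (e-irr : ∀ v → e v v ≡ false) where

  nbrs : X → List X → List X
  nbrs v = filter (λ u → e v u Bool.≟ true)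

  -- Counts v itself when v ∈ xs.
  nn : X → List X → ℕ
  nn v xs = ∑ xs (λ u → ind (not (e v u)))

  -- Ordered pairs are counted, the diagonal included: each missing edge contributes 2 and each
  -- vertex 1.
  NN : List X → ℕ
  NN xs = ∑ xs (λ v → nn v xs)

  does-≟-true : ∀ b → does (b Bool.≟ true) ≡ b
  does-≟-true true  = refl
  does-≟-true false = refl

  nbrs+nn : ∀ v xs → length (nbrs v xs) + nn v xs ≡ length xs
  nbrs+nn v xs = trans
    (cong (length (nbrs v xs) +_) (∑-cong xs (λ u → cong (ind ∘ not) (sym (does-≟-true (e v u))))))
    (length-filter-¬ (λ u → e v u Bool.≟ true) xs)

  nn-swap : ∀ xs ys → ∑ xs (λ x → nn x ys) ≡ ∑ ys (λ y → nn y xs)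
  nn-swap xs ys = trans (∑-swap xs ys _) (∑-cong ys λ y → ∑-cong xs λ x → cong (ind ∘ not) (e-sym x y))

  -- Disjointness of the classes needs no field: a vertex `v` in two classes would give
  -- `e v v ≡ true` by `joined`, against irreflexivity.
  record Blowup (V : List X) (r t : ℕ) : Set where
    field
      class  : Fin r → List X
      card   : ∀ i → length (class i) ≡ t
      unique : ∀ i → Unique (class i)
      within : ∀ i {v} → v ∈ class i → v ∈ V
      joined : ∀ {i j} → i ≢ j → ∀ {u v} → u ∈ class i → v ∈ class j → e u v ≡ true

  shrink : ∀ {V r} t (class : Fin r → List X) → (∀ i → t ≤ length (class i)) → (∀ i → Unique (class i)) →
    (∀ i {v} → v ∈ class i → v ∈ V) → (∀ {i j} → i ≢ j → ∀ {u v} → u ∈ class i → v ∈ class j → e u v ≡ true) →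
    Blowup V r t
  shrink t class large uniq within joined = record
    { class  = take t ∘ class
    ; card   = λ i → trans (length-take t (class i)) (m≤n⇒m⊓n≡m (large i))
    ; unique = λ i → Unique.take⁺ t (uniq i)
    ; within = λ i p → within i (∈-take t (class i) p)
    ; joined = λ i≢j p q → joined i≢j (∈-take t (class _) p) (∈-take t (class _) q)
    }

  Homogeneous : List X → List X → Set
  Homogeneous A B = ∀ {a u v} → a ∈ A → u ∈ B → v ∈ B → e a u ≡ e a v

  -- Split `B` by adjacency to one element of `A` and keep the larger part. Each element costs a
  -- factor 2, and in the end all vertices kept have the same neighbours in `A`.
  homogenize : ∀ A B s → Unique B → 2 ^ length A * s ≤ length B →
    ∃ λ B′ → Unique B′ × (∀ {v} → v ∈ B′ → v ∈ B) × s ≤ length B′ × Homogeneous A B′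
  homogenize []      B s uB le = B , uB , (λ p → p) , ≤-trans (≤-reflexive (sym (*-identityˡ s))) le , λ ()
  homogenize (a ∷ A) B s uB le = go (≤-total (length B₁) (length B₀))
    where
    h = 2 ^ length A * s
    B₁ = filter (λ u → e a u Bool.≟ true) B
    B₀ = filter (λ u → ¬? (e a u Bool.≟ true)) B
    split : length B₁ + length B₀ ≡ length B
    split = trans (cong (length B₁ +_) (length-filter (λ u → ¬? (e a u Bool.≟ true)) B))
                  (length-filter-¬ (λ u → e a u Bool.≟ true) B)
    dbl : h + h ≤ length B₁ + length B₀
    dbl = subst₂ _≤_ (lem (2 ^ length A) s) (sym split) le
      where
      lem : ∀ x y → 2 * x * y ≡ x * y + x * y
      lem = solve-∀
    half : ∀ {x y} → x ≤ y → h + h ≤ x + y → h ≤ y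
    half {x} {y} x≤y p = ≮⇒≥ λ y<h → <⇒≱ (+-mono-< (≤-<-trans x≤y y<h) y<h) p
    extend : ∀ {P : X → Set} (P? : Decidable P) → (∀ {u v} → P u → P v → e a u ≡ e a v) →
      h ≤ length (filter P? B) →
      ∃ λ B′ → Unique B′ × (∀ {v} → v ∈ B′ → v ∈ B) × s ≤ length B′ × Homogeneous (a ∷ A) B′
    extend P? same le′ with homogenize A (filter P? B) s (Unique.filter⁺ P? uB) le′
    ... | B′ , uB′ , sub , large , hom = B′ , uB′ , proj₁ ∘ ∈-filter⁻ P? ∘ sub , large , hom′
      where
      hom′ : Homogeneous (a ∷ A) B′
      hom′ (here refl) u∈ v∈ = same (proj₂ (∈-filter⁻ P? {xs = B} (sub u∈))) (proj₂ (∈-filter⁻ P? {xs = B} (sub v∈)))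
      hom′ (there a∈)  u∈ v∈ = hom a∈ u∈ v∈
    go : length B₁ ≤ length B₀ ⊎ length B₀ ≤ length B₁ → _
    go (inj₁ le₁) = extend (λ u → ¬? (e a u Bool.≟ true)) (λ p q → trans (Bool.¬-not p) (sym (Bool.¬-not q))) (half le₁ dbl)
    go (inj₂ le₀) = extend (λ u → e a u Bool.≟ true) (λ p q → trans p (sym q))
                      (half le₀ (subst (h + h ≤_) (+-comm (length B₁) _) dbl))

  -- One step of the Erdős–Stone induction: by double counting non-adjacent pairs,
  -- a positive proportion of V has at least suc t neighbours in every class.
  addClass : ∀ q r t {V} → Unique V → (∀ {v} → v ∈ V → suc q * suc r * nn v V ≤ q * length V) →
    suc q * suc q * (2 ^ (suc r * ((2 + q) * suc t)) * suc t) ≤ length V →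
    Blowup V (suc r) ((2 + q) * suc t) → Blowup V (suc (suc r)) t
  addClass q r t {V} uV sparse big K = finish (homogenize A B s (Unique.filter⁺ good? uV) enough)
    where
    open Blowup K
    -- The successor keeps `B′` below nonempty even for `t = 0`, so that it has an element `w`.
    s = suc t
    T = (2 + q) * s
    R = suc r
    A = concatMap class (allFin R)

    |A|≡RT : length A ≡ R * T
    |A|≡RT = trans (length-concatMap-const class (allFin R) card) (cong (_* T) (length-allFin R))

    ∈A : ∀ i {v} → v ∈ class i → v ∈ A
    ∈A i p = ∈-concatMap⁺ class (Any.map (λ { refl → p }) (∈-allFin i))

    A⊆V : ∀ {v} → v ∈ A → v ∈ V
    A⊆V p with find (∈-concatMap⁻ class {xs = allFin R} p)
    ... | i , _ , q = within i q

    good? : Decidable (λ v → ∀ i → s ≤ length (nbrs v (class i)))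
    good? v = Fin.all? (λ i → s ≤? length (nbrs v (class i)))

    B = filter good? V
    bad : X → ℕ
    bad v = ind (not (does (good? v)))

    -- A bad vertex has fewer than `s` neighbours in some class. That class has `(2 + q) * s`
    -- elements, so at least `suc q * s` of them are non-neighbours.
    bad-nn : ∀ v (good : Dec (∀ i → s ≤ length (nbrs v (class i)))) → suc q * s * ind (not (does good)) ≤ nn v A
    bad-nn v (yes _) = subst (_≤ nn v A) (sym (*-zeroʳ (suc q * s))) z≤n
    bad-nn v (no ¬good) with Fin.¬∀⟶∃¬ R _ (λ i → s ≤? length (nbrs v (class i))) ¬good
    ... | i , few = begin
      suc q * s * 1                            ≡⟨ *-identityʳ (suc q * s) ⟩
      suc q * s                                ≤⟨ +-cancelˡ-≤ s _ _ step ⟩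
      nn v (class i)                           ≤⟨ ∈⇒≤∑ (λ i → nn v (class i)) (∈-allFin i) ⟩
      ∑ (allFin R) (λ i → nn v (class i))      ≡⟨ ∑-concatMap class (allFin R) _ ⟨
      nn v A                                   ∎
      where
      open ≤-Reasoning
      step : s + suc q * s ≤ s + nn v (class i)
      step = begin
        (2 + q) * s                                       ≡⟨ card i ⟨
        length (class i)                                  ≡⟨ nbrs+nn v (class i) ⟨
        length (nbrs v (class i)) + nn v (class i)        ≤⟨ +-monoˡ-≤ _ (<⇒≤ (≰⇒> few)) ⟩
        s + nn v (class i)                                ∎

    -- The missing pairs between `V` and `A` are counted from the side of `A`, where each vertex
    -- obeys `sparse`.
    nn-A : suc q * ∑ V (λ v → nn v A) ≤ T * (q * length V)
    nn-A = *-cancelˡ-≤ R (begin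
      R * (suc q * ∑ V (λ v → nn v A))         ≡⟨ cong (λ z → R * (suc q * z)) (nn-swap V A) ⟩
      R * (suc q * ∑ A (λ a → nn a V))         ≡⟨ lem R (suc q) _ ⟩
      suc q * R * ∑ A (λ a → nn a V)           ≡⟨ ∑-*ˡ (suc q * R) A _ ⟨
      ∑ A (λ a → suc q * R * nn a V)           ≤⟨ ∑-mono A (sparse ∘ A⊆V) ⟩
      ∑ A (λ _ → q * length V)                 ≡⟨ ∑-const A _ ⟩
      length A * (q * length V)                ≡⟨ cong (_* (q * length V)) |A|≡RT ⟩
      R * T * (q * length V)                   ≡⟨ *-assoc R T _ ⟩
      R * (T * (q * length V))                 ∎)
      where
      open ≤-Reasoning
      lem : ∀ a b c → a * (b * c) ≡ b * a * c
      lem = solve-∀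

    ∑bad = ∑ V bad

    few-bad : suc q * suc q * ∑bad ≤ (2 + q) * q * length V
    few-bad = *-cancelˡ-≤ s (begin
      s * (suc q * suc q * ∑bad)               ≡⟨ lem₁ s (suc q) ∑bad ⟩
      suc q * (suc q * s * ∑bad)               ≡⟨ cong (suc q *_) (∑-*ˡ (suc q * s) V bad) ⟨
      suc q * ∑ V (λ v → suc q * s * bad v)    ≤⟨ *-monoʳ-≤ (suc q) (∑-mono V (λ {v} _ → bad-nn v (good? v))) ⟩
      suc q * ∑ V (λ v → nn v A)               ≤⟨ nn-A ⟩
      (2 + q) * s * (q * length V)             ≡⟨ lem₂ (2 + q) s q (length V) ⟩
      s * ((2 + q) * q * length V)             ∎)
      where
      open ≤-Reasoning
      lem₁ : ∀ a b c → a * (b * b * c) ≡ b * (b * a * c)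
      lem₁ = solve-∀
      lem₂ : ∀ a b c d → a * b * (c * d) ≡ b * (a * c * d)
      lem₂ = solve-∀

    |V| : length B + ∑bad ≡ length V
    |V| = length-filter-¬ good? V

    -- Since `(1 + q)² = (2 + q) * q + 1`, the bound on bad vertices leaves a proportion of at least
    -- `1 / (1 + q)²` good ones.
    many-good : length V ≤ suc q * suc q * length B
    many-good = begin
      length V                                 ≡⟨ |V| ⟨
      length B + ∑bad                          ≤⟨ +-monoʳ-≤ (length B) (+-cancelˡ-≤ ((2 + q) * q * ∑bad) _ _ step) ⟩
      length B + (2 + q) * q * length B        ≡⟨ lem₂ q (length B) ⟩
      suc q * suc q * length B                 ∎
      where
      open ≤-Reasoning
      lem₁ : ∀ q b → (2 + q) * q * b + b ≡ (1 + q) * (1 + q) * b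
      lem₁ = solve-∀
      lem₂ : ∀ q b → b + (2 + q) * q * b ≡ (1 + q) * (1 + q) * b
      lem₂ = solve-∀
      lem₃ : ∀ c a b → c * (a + b) ≡ c * b + c * a
      lem₃ = solve-∀
      step : (2 + q) * q * ∑bad + ∑bad ≤ (2 + q) * q * ∑bad + (2 + q) * q * length B
      step = begin
        (2 + q) * q * ∑bad + ∑bad                        ≡⟨ lem₁ q ∑bad ⟩
        suc q * suc q * ∑bad                             ≤⟨ few-bad ⟩
        (2 + q) * q * length V                           ≡⟨ cong ((2 + q) * q *_) |V| ⟨
        (2 + q) * q * (length B + ∑bad)                  ≡⟨ lem₃ ((2 + q) * q) (length B) ∑bad ⟩
        (2 + q) * q * ∑bad + (2 + q) * q * length B      ∎

    enough : 2 ^ length A * s ≤ length B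
    enough = subst (λ a → 2 ^ a * s ≤ length B) (sym |A|≡RT)
      (*-cancelˡ-≤ (suc q * suc q) (≤-trans big many-good))

    finish : (∃ λ B′ → Unique B′ × (∀ {v} → v ∈ B′ → v ∈ B) × s ≤ length B′ × Homogeneous A B′) →
      Blowup V (suc R) t
    finish ([]      , _   , _   , ()    , _)
    -- `B′` is the new class, and each old class is cut down to the neighbours of `w`. There are
    -- enough of these as `w` is good, and by homogeneity they are adjacent to all of `B′`.
    finish (B′@(w ∷ _) , uB′ , sub , large , hom) = shrink t class′ large′ unique′ within′ joined′
      where
      wNbr? = λ u → e w u Bool.≟ true
      class′ : Fin (suc R) → List X
      class′ zero    = B′
      class′ (suc i) = nbrs w (class i)
      large′ : ∀ i → t ≤ length (class′ i)
      large′ zero    = <⇒≤ large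
      large′ (suc i) = <⇒≤ (proj₂ (∈-filter⁻ good? {xs = V} (sub (here refl))) i)
      unique′ : ∀ i → Unique (class′ i)
      unique′ zero    = uB′
      unique′ (suc i) = Unique.filter⁺ wNbr? (unique i)
      within′ : ∀ i {v} → v ∈ class′ i → v ∈ V
      within′ zero    p = proj₁ (∈-filter⁻ good? {xs = V} (sub p))
      within′ (suc i) p = within i (proj₁ (∈-filter⁻ wNbr? p))
      joined₀ : ∀ {j u v} → u ∈ B′ → v ∈ nbrs w (class j) → e u v ≡ true
      joined₀ {j} {u} {v} u∈ v∈ with ∈-filter⁻ wNbr? {xs = class j} v∈
      ... | v∈C , ewv = begin
        e u v  ≡⟨ e-sym u v ⟩
        e v u  ≡⟨ hom (∈A j v∈C) u∈ (here refl) ⟩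
        e v w  ≡⟨ e-sym v w ⟩
        e w v  ≡⟨ ewv ⟩
        true   ∎
        where open ≡-Reasoning
      joined′ : ∀ {i j} → i ≢ j → ∀ {u v} → u ∈ class′ i → v ∈ class′ j → e u v ≡ true
      joined′ {zero}  {zero}  i≢j _  _  = contradiction refl i≢j
      joined′ {zero}  {suc j} _   u∈ v∈ = joined₀ u∈ v∈
      joined′ {suc i} {zero}  _   u∈ v∈ = trans (e-sym _ _) (joined₀ v∈ u∈)
      joined′ {suc i} {suc j} i≢j u∈ v∈ =
        joined (i≢j ∘ cong suc) (proj₁ (∈-filter⁻ wNbr? u∈)) (proj₁ (∈-filter⁻ wNbr? v∈))

  -- For `r > 0` the hypothesis is minimum degree at least `(1 - 1/r + 1/((q + 1) r)) |V|`. It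
  -- becomes weaker as `r` decreases, so the induction on `r` keeps the same `V` and adds one class
  -- at a time.
  sparse⇒blowup : ∀ r q t {V} → Unique V → blowupThreshold r q t ≤ length V →
    (∀ {v} → v ∈ V → suc q * r * nn v V ≤ q * length V) → Blowup V (suc r) t
  sparse⇒blowup zero    q t {V} uV big sparse = shrink t (λ _ → V) (λ _ → big) (λ _ → uV) (λ _ p → p)
    λ { {zero} {zero} i≢j → contradiction refl i≢j }
  sparse⇒blowup (suc r) q t {V} uV big sparse =
    addClass q r t uV sparse (≤-trans (m≤n+m _ (blowupThreshold r q ((2 + q) * suc t))) big)
      (sparse⇒blowup r q ((2 + q) * suc t) uV (≤-trans (m≤m+n _ _) big)
        λ v∈ → ≤-trans (*-monoˡ-≤ (nn _ V) (*-monoʳ-≤ (suc q) (n≤1+n r))) (sparse v∈))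

  -- Deleting `v` removes its row and its column of the matrix of missing pairs. They share the
  -- diagonal entry, which is 1; the `+ 1` corrects for counting it twice.
  NN-delete : ∀ v {xs ys} → xs ↭ v ∷ ys → NN xs + 1 ≡ NN ys + 2 * nn v xs
  NN-delete v {xs} {ys} p = begin
    NN xs + 1                                  ≡⟨ cong (_+ 1) (trans (∑-cong xs λ x → ∑-↭ _ p) (∑-↭ _ p)) ⟩
    NN (v ∷ ys) + 1                            ≡⟨⟩
    (ind (not (e v v)) + nn v ys) + ∑ ys (λ x → ind (not (e x v)) + nn x ys) + 1
      ≡⟨ cong₂ (λ b z → (ind (not b) + nn v ys) + z + 1) (e-irr v) (trans (∑-+ ys _ _) (cong (_+ NN ys) col)) ⟩
    (1 + nn v ys) + (nn v ys + NN ys) + 1      ≡⟨ lem (nn v ys) (NN ys) ⟩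
    NN ys + 2 * (1 + nn v ys)
      ≡⟨ cong (λ z → NN ys + 2 * z) (trans (∑-↭ _ p) (cong (λ b → ind (not b) + nn v ys) (e-irr v))) ⟨
    NN ys + 2 * nn v xs                        ∎
    where
    open ≡-Reasoning
    col : ∑ ys (λ x → ind (not (e x v))) ≡ nn v ys
    col = ∑-cong ys λ x → cong (ind ∘ not) (e-sym x v)
    lem : ∀ a b → (1 + a) + (a + b) + 1 ≡ b + 2 * (1 + a)
    lem = solve-∀

  -- Deleting vertices with too many non-neighbours, one at a time, cannot go on
  -- below N vertices unless the whole graph misses many pairs.
  sparseCore : ∀ q R N m V → length V ≡ m → Unique V →
    (∃ λ V′ → Unique V′ × N ≤ length V′ × (∀ {v} → v ∈ V′ → R * nn v V′ ≤ q * length V′))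
    ⊎ q * (m * m) ≤ R * NN V + R * m + q * (N * N)
  sparseCore q R N m V |V| uV with N ≤? m
  ... | no N≰m = inj₂ (≤-trans (*-monoʳ-≤ q (*-mono-≤ m≤N m≤N)) (m≤n+m _ _))
    where m≤N = <⇒≤ (≰⇒> N≰m)
  ... | yes N≤m with All.all? (λ v → R * nn v V ≤? q * length V) V
  ...   | yes sparse = inj₁ (V , uV , subst (N ≤_) (sym |V|) N≤m , All.lookup sparse)
  sparseCore q R N zero    V |V| uV | yes _ | no _ = inj₂ (≤-trans (≤-reflexive (*-zeroʳ q)) z≤n)
  sparseCore q R N (suc m) V |V| uV | yes _ | no ¬sparse
    with find (¬All⇒Any¬ (λ v → R * nn v V ≤? q * length V) V ¬sparse)
  ... | v , v∈V , dense with ∈⇒↭ v∈V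
  ...   | V′ , p with Unique-resp-↭ p uV
  ...     | _ ∷ uV′ with sparseCore q R N m V′ (suc-injective (trans (sym (↭-length p)) |V|)) uV′
  ...       | inj₁ core = inj₁ core
  -- Putting `v` back raises `q * m²` by at most `2 * q * suc m`, which the missing pairs at `v` pay
  -- for as `v` is dense. The summand `R * m` grows by one `R` to absorb the diagonal correction of
  -- `NN-delete`.
  ...       | inj₂ ih   = inj₂ (+-cancelʳ-≤ R _ _ (begin
    q * (suc m * suc m) + R                                  ≤⟨ +-monoˡ-≤ R (*-monoʳ-≤ q (n≤1+n _)) ⟩
    q * (1 + suc m * suc m) + R                              ≡⟨ lem₁ q m R ⟩
    q * (m * m) + 2 * (q * suc m) + R                        ≤⟨ +-monoˡ-≤ R (+-mono-≤ ih (*-monoʳ-≤ 2 dense′)) ⟩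
    R * NN V′ + R * m + q * (N * N) + 2 * (R * nn v V) + R   ≡⟨ lem₂ R (NN V′) m (q * (N * N)) (nn v V) ⟩
    R * (NN V′ + 2 * nn v V) + R * suc m + q * (N * N)
      ≡⟨ cong (λ z → R * z + R * suc m + q * (N * N)) (NN-delete v p) ⟨
    R * (NN V + 1) + R * suc m + q * (N * N)                 ≡⟨ lem₃ R (NN V) (R * suc m) (q * (N * N)) ⟩
    R * NN V + R * suc m + q * (N * N) + R                   ∎))
    where
    open ≤-Reasoning
    dense′ : q * suc m ≤ R * nn v V
    dense′ = subst (λ l → q * l ≤ R * nn v V) |V| (<⇒≤ (≰⇒> dense))
    lem₁ : ∀ q m R → q * (1 + (1 + m) * (1 + m)) + R ≡ q * (m * m) + 2 * (q * (1 + m)) + R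
    lem₁ = solve-∀
    lem₂ : ∀ R x m c y → R * x + R * m + c + 2 * (R * y) + R ≡ R * (x + 2 * y) + R * (1 + m) + c
    lem₂ = solve-∀
    lem₃ : ∀ R x m c → R * (x + 1) + m + c ≡ R * x + m + c + R
    lem₃ = solve-∀

-- Free sets of set mappings

-- Later pools are cut to size `L`. Then `s` elements are in play: `c` chosen ones and `m` pools.
-- They exclude at most themselves and `k` elements for each of the `s * s` ordered pairs; the `suc`
-- leaves one to choose.
poolSize : (k m c : ℕ) → ℕ
poolSize k zero    c = 0
poolSize k (suc m) c = L + suc (s + s * (s * k))
  where
  L = poolSize k m (suc c)
  s = c + m * L

module SetMapping {X : Set} (_≟_ : DecidableEquality X) (f : X → X → List X) where

  Avoids : X → (X → Set) → Set
  Avoids w P = ¬ P w × (∀ {a b} → P a → P b → w ∉ f a b)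

  Others : ∀ {m} → List X → (Fin m → X) → Fin m → X → Set
  Others W w i a = a ∈ W ⊎ ∃ λ j → j ≢ i × a ≡ w j

  -- The first pool is chosen so large that some w in it lies outside f a b for all a, b
  -- still in play: the elements W chosen earlier and the truncated later pools.
  freeChoice : ∀ k → (∀ a b → length (f a b) ≤ k) → ∀ m W (Q : Fin m → List X) → (∀ i → Unique (Q i)) →
    (∀ i → poolSize k m (length W) ≤ length (Q i)) →
    ∃ λ (w : Fin m → X) → (∀ i → w i ∈ Q i) × (∀ i → Avoids (w i) (Others W w i))
  freeChoice k |f| zero    W Q uQ large = (λ ()) , (λ ()) , (λ ())
  freeChoice k |f| (suc m) W Q uQ large with ∃-avoiding _≟_ (Q zero) bad (uQ zero) few
    where
    L = poolSize k m (suc (length W))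
    S = W ++ concatMap (take L ∘ Q ∘ suc) (allFin m)
    bad = S ++ concatMap (λ a → concatMap (f a) S) S
    |take| : ∀ i → length (take L (Q (suc i))) ≡ L
    |take| i = trans (length-take L (Q (suc i))) (m≤n⇒m⊓n≡m (≤-trans (m≤m+n L _) (large (suc i))))
    |S| : length S ≡ length W + m * L
    |S| = trans (length-++ W) (cong (length W +_)
      (trans (length-concatMap-const _ (allFin m) |take|) (cong (_* L) (length-allFin m))))
    few : length bad < length (Q zero)
    few = begin-strict
      length bad                                                    ≡⟨ length-++ S ⟩
      length S + length (concatMap (λ a → concatMap (f a) S) S)
        ≤⟨ +-monoʳ-≤ (length S) (length-concatMap-≤ _ S λ a → length-concatMap-≤ (f a) S (|f| a)) ⟩
      length S + length S * (length S * k)                          <⟨ n<1+n _ ⟩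
      suc (length S + length S * (length S * k))                    ≡⟨ cong (λ s → suc (s + s * (s * k))) |S| ⟩
      _                                                             ≤⟨ m≤n+m _ L ⟩
      poolSize k (suc m) (length W)                                 ≤⟨ large zero ⟩
      length (Q zero)                                               ∎
      where open ≤-Reasoning
  ... | w₀ , w₀∈ , w₀∉bad = w , w∈ , avoids
    where
    L = poolSize k m (suc (length W))
    Q′ = take L ∘ Q ∘ suc
    S = W ++ concatMap Q′ (allFin m)
    -- With `w₀` moved into `W`, the later choices avoid `w₀` and the sets of pairs containing it.
    -- Conversely they are taken from the cut pools `Q′`, all of whose elements and pairs `w₀`
    -- avoids already.
    rec = freeChoice k |f| m (w₀ ∷ W) Q′ (λ i → Unique.take⁺ L (uQ (suc i)))
      (λ i → ≤-reflexive (sym (trans (length-take L (Q (suc i)))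
        (m≤n⇒m⊓n≡m (≤-trans (m≤m+n L _) (large (suc i)))))))
    ws = proj₁ rec
    w : Fin (suc m) → X
    w zero    = w₀
    w (suc i) = ws i
    w∈ : ∀ i → w i ∈ Q i
    w∈ zero    = w₀∈
    w∈ (suc i) = ∈-take L (Q (suc i)) (proj₁ (proj₂ rec) i)
    others₀ : ∀ {a} → Others W w zero a → a ∈ S
    others₀ (inj₁ a∈W)                 = ∈-++⁺ˡ a∈W
    others₀ (inj₂ (zero , 0≢0 , _))    = contradiction refl 0≢0
    others₀ (inj₂ (suc j , _ , refl))  =
      ∈-++⁺ʳ W (∈-concatMap⁺ Q′ (Any.map (λ { refl → proj₁ (proj₂ rec) j }) (∈-allFin j)))
    others₊ : ∀ {i a} → Others W w (suc i) a → Others (w₀ ∷ W) ws i a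
    others₊ (inj₁ a∈W)                  = inj₁ (there a∈W)
    others₊ (inj₂ (zero , _ , refl))    = inj₁ (here refl)
    others₊ (inj₂ (suc j , j≢i , refl)) = inj₂ (j , j≢i ∘ cong suc , refl)
    avoids : ∀ i → Avoids (w i) (Others W w i)
    avoids zero    = (λ o → w₀∉bad (∈-++⁺ˡ (others₀ o)))
      , λ oa ob w₀∈f → w₀∉bad (∈-++⁺ʳ S (∈-concatMap⁺ _
          (Any.map (λ { refl → ∈-concatMap⁺ _ (Any.map (λ { refl → w₀∈f }) (others₀ ob)) }) (others₀ oa))))
    avoids (suc i) with proj₂ (proj₂ rec) i
    ... | fresh , free = fresh ∘ others₊ , λ oa ob → free (others₊ oa) (others₊ ob)

-- Shadows and Berge copies

members : ∀ {n} → Subset n → List (Fin n)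
members []            = []
members (inside  ∷ p) = zero ∷ map suc (members p)
members (outside ∷ p) = map suc (members p)

length-members : ∀ {n} (p : Subset n) → length (members p) ≡ ∣ p ∣
length-members []            = refl
length-members (inside  ∷ p) = cong suc (trans (length-map suc (members p)) (length-members p))
length-members (outside ∷ p) = trans (length-map suc (members p)) (length-members p)

∈-members : ∀ {n} {p : Subset n} {x} → x Subset.∈ p → x ∈ members p
∈-members here                          = here refl
∈-members {p = inside  ∷ p} (there x∈p) = there (∈-map⁺ suc (∈-members x∈p))
∈-members {p = outside ∷ p} (there x∈p) = ∈-map⁺ suc (∈-members x∈p)

module Shadow {k n} (H : KGraph k n) where

  Covers : Fin n → Fin n → Fin (size H) → Set
  Covers u v j = u Subset.∈ edge H j × v Subset.∈ edge H j

  covered? : ∀ u v → Dec (∃ (Covers u v))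
  covered? u v = Fin.any? (λ j → (u ∈? edge H j) ×-dec (v ∈? edge H j))

  covered-sym : ∀ u v → does (covered? u v) ≡ does (covered? v u)
  covered-sym u v = does-⇔ (mk⇔ flip flip) (covered? u v) (covered? v u)
    where
    flip : ∀ {u v} → ∃ (Covers u v) → ∃ (Covers v u)
    flip (j , u∈ , v∈) = j , v∈ , u∈

  -- A vertex of any hyperedge is covered together with itself, so the diagonal has to be excluded
  -- explicitly.
  adj : Fin n → Fin n → Bool
  adj u v = not (does (u Fin.≟ v)) ∧ does (covered? u v)

  adj-sym : ∀ u v → adj u v ≡ adj v u
  adj-sym u v = cong₂ (λ a b → not a ∧ b) (does-⇔ (mk⇔ sym sym) (u Fin.≟ v) (v Fin.≟ u)) (covered-sym u v)

  adj-irr : ∀ v → adj v v ≡ false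
  adj-irr v rewrite dec-true (v Fin.≟ v) refl = refl

  open Adjacency adj adj-sym adj-irr public

  -- Each ordered pair `(u , v)` is counted once: as a shadow edge with `u < v`, as one with
  -- `v < u`, or as a missing pair, which includes `u = v`.
  shadow+NN : shadowSize H + shadowSize H + NN (allFin n) ≡ n * n
  shadow+NN = begin
    ∑∑ lower + ∑∑ lower + ∑∑ missing                       ≡⟨ cong (λ z → ∑∑ lower + z + ∑∑ missing) (∑-swap F F lower) ⟩
    ∑∑ lower + ∑∑ (λ u v → lower v u) + ∑∑ missing         ≡⟨ cong (_+ ∑∑ missing) (∑∑-+ lower (λ u v → lower v u)) ⟨
    ∑∑ (λ u v → lower u v + lower v u) + ∑∑ missing        ≡⟨ ∑∑-+ (λ u v → lower u v + lower v u) missing ⟨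
    ∑∑ (λ u v → lower u v + lower v u + missing u v)       ≡⟨ ∑-cong F (λ u → ∑-cong F (λ v → one u v)) ⟩
    ∑∑ (λ _ _ → 1)                                         ≡⟨ ∑-cong F (λ _ → trans (∑-const F 1) (*-identityʳ _)) ⟩
    ∑ F (λ _ → length F)                                   ≡⟨ ∑-const F _ ⟩
    length F * length F                                    ≡⟨ cong₂ _*_ (length-allFin n) (length-allFin n) ⟩
    n * n                                                  ∎
    where
    open ≡-Reasoning
    F = allFin n
    ∑∑ : (Fin n → Fin n → ℕ) → ℕ
    ∑∑ g = ∑ F (λ u → ∑ F (g u))
    ∑∑-+ : ∀ g h → ∑∑ (λ u v → g u v + h u v) ≡ ∑∑ g + ∑∑ h
    ∑∑-+ g h = trans (∑-cong F (λ u → ∑-+ F (g u) (h u))) (∑-+ F _ _)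
    lower missing : Fin n → Fin n → ℕ
    lower u v = ind (does (toℕ u <? toℕ v) ∧ does (covered? u v))
    missing u v = ind (not (adj u v))
    one : ∀ u v → lower u v + lower v u + missing u v ≡ 1
    one u v rewrite covered-sym v u with <-cmp (toℕ u) (toℕ v)
    ... | tri< u<v u≢v v≮u
      rewrite dec-true (toℕ u <? toℕ v) u<v | dec-false (toℕ v <? toℕ u) v≮u | dec-false (u Fin.≟ v) (u≢v ∘ cong toℕ)
      with does (covered? u v)
    ...   | true  = refl
    ...   | false = refl
    one u v | tri> u≮v u≢v v<u
      rewrite dec-true (toℕ v <? toℕ u) v<u | dec-false (toℕ u <? toℕ v) u≮v | dec-false (u Fin.≟ v) (u≢v ∘ cong toℕ)
      with does (covered? u v)
    ...   | true  = refl
    ...   | false = refl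
    one u v | tri≈ u≮v u≡v v≮u
      rewrite dec-false (toℕ v <? toℕ u) v≮u | dec-false (toℕ u <? toℕ v) u≮v | dec-true (u Fin.≟ v) (Fin.toℕ-injective u≡v)
      = refl

  -- The default `[]` makes the set mapping total while its values still have at most `k` elements.
  chosenEdge : ∀ {u v} → Dec (∃ (Covers u v)) → List (Fin n)
  chosenEdge (yes (j , _)) = members (edge H j)
  chosenEdge (no _)        = []

  hyperedge : Fin n → Fin n → List (Fin n)
  hyperedge u v = chosenEdge (covered? u v)

  length-hyperedge : ∀ u v → length (hyperedge u v) ≤ k
  length-hyperedge u v with covered? u v
  ... | yes (j , _) = ≤-reflexive (trans (length-members (edge H j)) (uniform H j))
  ... | no _        = z≤n

  adj⇒hyperedge : ∀ u v → adj u v ≡ true → ∃ λ j → Covers u v j × hyperedge u v ≡ members (edge H j)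
  adj⇒hyperedge u v eq with covered? u v
  ... | yes (j , c) = j , c , refl
  ... | no _        = case trans (sym eq) (Bool.∧-zeroʳ _) of λ ()

  open SetMapping Fin._≟_ hyperedge

  -- If no vertex of the copy lies in the hyperedge chosen for a pair of other vertices of the copy,
  -- then that hyperedge determines the pair.
  blowup⇒Berge : ∀ (G : Graph) {V χ} → Colorable G χ → Blowup V χ (poolSize k (nv G) 0) → BergeCopy G H
  blowup⇒Berge G (col , proper) K
    -- The pool of a vertex of `G` is the class of its colour. Vertices of one colour share a pool;
    -- `free` keeps their images distinct.
    with freeChoice k length-hyperedge (nv G) [] (λ x → Blowup.class K (col x)) (λ x → Blowup.unique K (col x))
      (λ x → ≤-reflexive (sym (Blowup.card K (col x))))
  ... | w , w∈ , free = w , w-inj , f , f-inj , λ j → proj₁ (proj₂ (picked j))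
    where
    picked : ∀ j → _
    picked j = adj⇒hyperedge (w (src G j)) (w (tgt G j)) (Blowup.joined K (proper j) (w∈ (src G j)) (w∈ (tgt G j)))
    f : Fin (ne G) → Fin (size H)
    f j = proj₁ (picked j)
    w-inj : Injective _≡_ _≡_ w
    w-inj {x} {y} eq with x Fin.≟ y
    ... | yes x≡y = x≡y
    ... | no x≢y  = ⊥-elim (proj₁ (free x) (inj₂ (y , x≢y ∘ sym , eq)))
    endpoint : ∀ j x → w x Subset.∈ edge H (f j) → x ≡ src G j ⊎ x ≡ tgt G j
    endpoint j x x∈ with x Fin.≟ src G j | x Fin.≟ tgt G j
    ... | yes p | _     = inj₁ p
    ... | no _  | yes p = inj₂ p
    ... | no x≢s | no x≢t = ⊥-elim (proj₂ (free x) (inj₂ (src G j , x≢s ∘ sym , refl)) (inj₂ (tgt G j , x≢t ∘ sym , refl))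
          (subst (w x ∈_) (sym (proj₂ (proj₂ (picked j)))) (∈-members x∈)))
    f-inj : Injective _≡_ _≡_ f
    f-inj {j} {j′} eq with endpoint j (src G j′) (subst (λ h → w (src G j′) Subset.∈ edge H h) (sym eq) (proj₁ (proj₁ (proj₂ (picked j′)))))
                         | endpoint j (tgt G j′) (subst (λ h → w (tgt G j′) Subset.∈ edge H h) (sym eq) (proj₂ (proj₁ (proj₂ (picked j′)))))
    -- Both ends of `j′` are ends of `j`. They are distinct, so the two edges agree up to
    -- orientation and `simple` identifies them.
    ... | inj₁ p | inj₁ q = ⊥-elim (loopless G j′ (trans p (sym q)))
    ... | inj₁ p | inj₂ q = simple G j j′ (inj₁ (sym p , sym q))
    ... | inj₂ p | inj₁ q = simple G j j′ (inj₂ (sym q , sym p))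
    ... | inj₂ p | inj₂ q = ⊥-elim (loopless G j′ (trans p (sym q)))

-- Counting pairs and the upper bound on the shadow.

2*nC2+n≡n*n : ∀ n → 2 * (n C 2) + n ≡ n * n
2*nC2+n≡n*n zero    = refl
2*nC2+n≡n*n (suc n) = begin
  2 * (suc n C 2) + suc n          ≡⟨ cong (λ z → 2 * z + suc n) (nCk+nC[k+1]≡[n+1]C[k+1] n 1) ⟨
  2 * (n C 1 + n C 2) + suc n      ≡⟨ cong (λ z → 2 * (z + n C 2) + suc n) (nC1≡n n) ⟩
  2 * (n + n C 2) + suc n          ≡⟨ lem₁ n (n C 2) ⟩
  (2 * (n C 2) + n) + (1 + 2 * n)  ≡⟨ cong (_+ (1 + 2 * n)) (2*nC2+n≡n*n n) ⟩
  n * n + (1 + 2 * n)              ≡⟨ lem₂ n ⟩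
  suc n * suc n                    ∎
  where
  open ≡-Reasoning
  lem₁ : ∀ n c → 2 * (n + c) + (1 + n) ≡ (2 * c + n) + (1 + 2 * n)
  lem₁ = solve-∀
  lem₂ : ∀ n → n * n + (1 + 2 * n) ≡ (1 + n) * (1 + n)
  lem₂ = solve-∀

-- Chosen so that `n` times it is at least `n + 2 * (R * n) + q * (N₀ * N₀)`, the sum of the error
-- terms in the final estimate.
bergeThreshold : (k : ℕ) (G : Graph) (r q : ℕ) → ℕ
bergeThreshold k G r q = 1 + (2 * R + q * (N₀ * N₀))
  where
  R = suc q * r
  N₀ = blowupThreshold r q (poolSize k (nv G) 0)

-- The inequality says S ≤ (1 − 1/r + 1/(q+1)) C(n,2), with denominators cleared.
shadow-upper : ∀ k (G : Graph) r′ q → let r = 2 + r′; R = suc q * r in Colorable G (suc r) →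
  ∀ n → n ≥ bergeThreshold k G r q → (H : KGraph k n) → BergeFree G H →
  R * shadowSize H + suc q * (n C 2) ≤ (R + r) * (n C 2)
shadow-upper k G r′ q colorable n big H free = ≮⇒≥ impossible
  where
  open Shadow H
  r = 2 + r′
  R = suc q * r
  N₀ = blowupThreshold r q (poolSize k (nv G) 0)
  S = shadowSize H
  c = n C 2
  D = 2 * c
  M = NN (allFin n)
  K = q * (N₀ * N₀)

  impossible : ¬ ((R + r) * c < R * S + suc q * c)
  -- A core of high minimum degree contains a blow-up and hence a Berge copy. Without such a core,
  -- too many pairs are missing for `dense` to hold.
  impossible dense with sparseCore q R N₀ n (allFin n) (length-allFin n) (Unique.allFin⁺ n)
  ... | inj₁ (V , uV , large , sparse) = free (blowup⇒Berge G colorable (sparse⇒blowup r q _ uV large sparse))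
  ... | inj₂ missing = <⇒≱ too-many-pairs (begin
      n + 2 * (R * n) + K              ≤⟨ +-monoʳ-≤ (n + 2 * (R * n)) (m≤n*m K n {{n≢0}}) ⟩
      n + 2 * (R * n) + n * K          ≡⟨ lem n R K ⟩
      n * (1 + (2 * R + K))            ≤⟨ *-monoʳ-≤ n big ⟩
      n * n                            ∎)
    where
    open ≤-Reasoning
    n≢0 : NonZero n
    n≢0 = >-nonZero (≤-trans (s≤s z≤n) big)
    lem : ∀ n R K → n + 2 * (R * n) + n * K ≡ n * (1 + (2 * R + K))
    lem = solve-∀

    -- This is twice `dense`, with `S + S` expressed through `M` by `S + S + M = n * n = D + n`.
    doubled : r * D + R * M < R * n + suc q * D
    doubled = +-cancelʳ-< (R * D) _ _ (begin-strict
      r * D + R * M + R * D                     ≡⟨ lem₁ r R c M ⟩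
      2 * ((R + r) * c) + R * M                 <⟨ +-monoˡ-< (R * M) (*-monoʳ-< 2 dense) ⟩
      2 * (R * S + suc q * c) + R * M           ≡⟨ lem₂ R S (suc q) c M ⟩
      R * (S + S + M) + suc q * D               ≡⟨ cong (λ z → R * z + suc q * D) (trans shadow+NN (sym (2*nC2+n≡n*n n))) ⟩
      R * (D + n) + suc q * D                   ≡⟨ lem₃ R D n (suc q) ⟩
      R * n + suc q * D + R * D                 ∎)
      where
      lem₁ : ∀ r R c M → r * (2 * c) + R * M + R * (2 * c) ≡ 2 * ((R + r) * c) + R * M
      lem₁ = solve-∀
      lem₂ : ∀ R S p c M → 2 * (R * S + p * c) + R * M ≡ R * (S + S + M) + p * (2 * c)
      lem₂ = solve-∀
      lem₃ : ∀ R D n p → R * (D + n) + p * D ≡ R * n + p * D + R * D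
      lem₃ = solve-∀

    -- `missing` has leading term `q * n²`, whereas `doubled` bounds `R * M` by about
    -- `(1 + q - r) * n²`. As `r` is at least 2, a surplus of order `n²` remains against terms at
    -- most linear in `n`.
    too-many-pairs : n * n < n + 2 * (R * n) + K
    too-many-pairs = +-cancelʳ-< (suc q * D + R * M) _ _ (begin-strict
      n * n + (suc q * D + R * M)                             ≡⟨ cong (_+ (suc q * D + R * M)) (2*nC2+n≡n*n n) ⟨
      D + n + (suc q * D + R * M)                             ≡⟨ lem₁ D n q (R * M) ⟩
      q * D + n + (2 * D + R * M)                             ≤⟨ +-mono-≤ (+-monoˡ-≤ n (m≤m+n (q * D) (q * n)))
                                                                   (+-monoˡ-≤ (R * M) (*-monoˡ-≤ D (m≤m+n 2 r′))) ⟩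
      q * D + q * n + n + (r * D + R * M)                     ≡⟨ cong (λ z → z + n + (r * D + R * M))
                                                                   (trans (sym (*-distribˡ-+ q D n)) (cong (q *_) (2*nC2+n≡n*n n))) ⟩
      q * (n * n) + n + (r * D + R * M)                       <⟨ +-mono-≤-< (+-monoˡ-≤ n missing) doubled ⟩
      R * M + R * n + K + n + (R * n + suc q * D)             ≡⟨ lem₂ (R * M) (R * n) K n (suc q * D) ⟩
      n + 2 * (R * n) + K + (suc q * D + R * M)               ∎)
      where
      lem₁ : ∀ D n q m → D + n + ((1 + q) * D + m) ≡ q * D + n + (2 * D + m)
      lem₁ = solve-∀
      lem₂ : ∀ m x K n y → m + x + K + n + (x + y) ≡ n + 2 * x + K + (y + m)
      lem₂ = solve-∀

-- The transversal hypergraph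

Unique⇒lookup-injective : ∀ {X : Set} {xs : List X} → Unique xs → Injective _≡_ _≡_ (lookup xs)
Unique⇒lookup-injective (_ ∷ _)  {zero}  {zero}  _  = refl
Unique⇒lookup-injective (x∉ ∷ _) {zero}  {suc j} eq = contradiction eq (All.lookup x∉ (∈-lookup j))
Unique⇒lookup-injective (x∉ ∷ _) {suc i} {zero}  eq = contradiction (sym eq) (All.lookup x∉ (∈-lookup i))
Unique⇒lookup-injective (_ ∷ u)  {suc i} {suc j} eq = cong suc (Unique⇒lookup-injective u eq)

allSubsets : ∀ n → List (Subset n)
allSubsets zero    = [] ∷ []
allSubsets (suc n) = map (inside ∷_) (allSubsets n) ++ map (outside ∷_) (allSubsets n)

∈-allSubsets : ∀ {n} (p : Subset n) → p ∈ allSubsets n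
∈-allSubsets []            = here refl
∈-allSubsets (inside  ∷ p) = ∈-++⁺ˡ (∈-map⁺ (inside ∷_) (∈-allSubsets p))
∈-allSubsets (outside ∷ p) = ∈-++⁺ʳ _ (∈-map⁺ (outside ∷_) (∈-allSubsets p))

allSubsets-unique : ∀ n → Unique (allSubsets n)
allSubsets-unique zero    = [] ∷ []
allSubsets-unique (suc n) = Unique.++⁺ (Unique.map⁺ ∷-injectiveʳ (allSubsets-unique n))
  (Unique.map⁺ ∷-injectiveʳ (allSubsets-unique n))
  λ (p∈ , q∈) → case ∈-map⁻ (inside ∷_) p∈ , ∈-map⁻ (outside ∷_) q∈ of λ { ((_ , _ , refl) , (_ , _ , ())) }

∈-insert⁻ : ∀ {n} (p : Subset n) x {y} → y Subset.∈ p [ x ]≔ inside → y ≡ x ⊎ y Subset.∈ p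
∈-insert⁻ (_ ∷ p) zero    here      = inj₁ refl
∈-insert⁻ (_ ∷ p) zero    (there q) = inj₂ (there q)
∈-insert⁻ (_ ∷ p) (suc x) here      = inj₂ here
∈-insert⁻ (_ ∷ p) (suc x) (there q) with ∈-insert⁻ p x q
... | inj₁ refl = inj₁ refl
... | inj₂ y∈p  = inj₂ (there y∈p)

∈-insert⁺ : ∀ {n} (p : Subset n) x {y} → y Subset.∈ p → y Subset.∈ p [ x ]≔ inside
∈-insert⁺ p x {y} y∈p with y Fin.≟ x
... | yes refl = []≔-updates p x
... | no y≢x   = []≔-minimal p y x y≢x y∈p

∣insert∣ : ∀ {n} (p : Subset n) x → x Subset.∉ p → ∣ p [ x ]≔ inside ∣ ≡ suc ∣ p ∣
∣insert∣ (inside  ∷ p) zero    x∉p = contradiction here x∉p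
∣insert∣ (outside ∷ p) zero    x∉p = refl
∣insert∣ (inside  ∷ p) (suc x) x∉p = cong suc (∣insert∣ p x (x∉p ∘ there))
∣insert∣ (outside ∷ p) (suc x) x∉p = ∣insert∣ p x (x∉p ∘ there)

module Transversals (k r M′ : ℕ) (2≤k : 2 ≤ k) (k≤r : k ≤ r) where

  -- The part size is a successor, so every part has a first vertex `combine c zero`, which `extend`
  -- can add.
  M n : ℕ
  M = suc M′
  n = r * M

  part : Fin n → Fin r
  part = quotient M

  Transversal : Subset n → Set
  Transversal p = ∀ x y → x Subset.∈ p → y Subset.∈ p → part x ≡ part y → x ≡ y

  transversal? : Decidable Transversal
  transversal? p = Fin.all? λ x → Fin.all? λ y →
    (x ∈? p) →-dec ((y ∈? p) →-dec ((part x Fin.≟ part y) →-dec (x Fin.≟ y)))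

  insert-transversal : ∀ {p x} → Transversal p → (∀ {y} → y Subset.∈ p → part x ≢ part y) →
    Transversal (p [ x ]≔ inside)
  insert-transversal {p} {x} tp new y z y∈ z∈ eq with ∈-insert⁻ p x y∈ | ∈-insert⁻ p x z∈
  ... | inj₁ refl | inj₁ refl = refl
  ... | inj₁ refl | inj₂ z∈p  = contradiction eq (new z∈p)
  ... | inj₂ y∈p  | inj₁ refl = contradiction (sym eq) (new y∈p)
  ... | inj₂ y∈p  | inj₂ z∈p  = tp y z y∈p z∈p eq

  -- As long as `p` has fewer than `k` vertices, it meets fewer than `r` parts because `k ≤ r`; a
  -- vertex of a part not yet met is added. `d` counts the vertices still to come.
  extend : ∀ d p → Transversal p → d + ∣ p ∣ ≡ k →
    ∃ λ p′ → Transversal p′ × ∣ p′ ∣ ≡ k × (∀ {x} → x Subset.∈ p → x Subset.∈ p′)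
  extend zero    p tp eq = p , tp , eq , λ x∈ → x∈
  extend (suc d) p tp eq
    with ∃-avoiding Fin._≟_ (allFin r) (map part (members p)) (Unique.allFin⁺ r) few
    where
    few : length (map part (members p)) < length (allFin r)
    few = begin-strict
      length (map part (members p))  ≡⟨ trans (length-map part (members p)) (length-members p) ⟩
      ∣ p ∣                          <⟨ s≤s (m≤n+m ∣ p ∣ d) ⟩
      suc d + ∣ p ∣                  ≡⟨ eq ⟩
      k                              ≤⟨ k≤r ⟩
      r                              ≡⟨ length-allFin r ⟨
      length (allFin r)              ∎
      where open ≤-Reasoning
  ... | c , _ , c∉ = let p′ , tp′ , |p′| , sub = extend d (p [ x ]≔ inside) (insert-transversal tp new) size′ in
      p′ , tp′ , |p′| , sub ∘ ∈-insert⁺ p x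
    where
    x : Fin n
    x = combine c zero
    new : ∀ {y} → y Subset.∈ p → part x ≢ part y
    new y∈ px≡py = c∉ (subst (_∈ map part (members p))
      (trans (sym px≡py) (cong proj₁ (Fin.remQuot-combine c zero))) (∈-map⁺ part (∈-members y∈)))
    size′ : d + ∣ p [ x ]≔ inside ∣ ≡ k
    size′ = trans (cong (d +_) (∣insert∣ p x λ x∈ → new x∈ refl)) (trans (+-suc d _) eq)

  through : ∀ u v → part u ≢ part v → ∃ λ p → Transversal p × ∣ p ∣ ≡ k × u Subset.∈ p × v Subset.∈ p
  through u v pu≢pv = let p , tp , |p| , sub = extend (k ∸ 2) pair pair-transversal pair-size in
      p , tp , |p| , sub ([]≔-updates Subset.⁅ v ⁆ u) , sub (∈-insert⁺ Subset.⁅ v ⁆ u (x∈⁅x⁆ v))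
    where

    pair : Subset n
    pair = Subset.⁅ v ⁆ [ u ]≔ inside
    pair-transversal : Transversal pair
    pair-transversal = insert-transversal (λ x y x∈ y∈ _ → trans (x∈⁅y⁆⇒x≡y v x∈) (sym (x∈⁅y⁆⇒x≡y v y∈)))
      λ y∈ eq → pu≢pv (trans eq (cong part (x∈⁅y⁆⇒x≡y v y∈)))
    pair-size : k ∸ 2 + ∣ pair ∣ ≡ k
    pair-size = trans (cong (k ∸ 2 +_) (trans (∣insert∣ Subset.⁅ v ⁆ u λ u∈ → pu≢pv (cong part (x∈⁅y⁆⇒x≡y v u∈)))
      (cong suc (∣⁅x⁆∣≡1 v)))) (m∸n+n≡m 2≤k)

  edge? : Decidable (λ p → ∣ p ∣ ≡ k × Transversal p)
  edge? p = (∣ p ∣ ≟ k) ×-dec transversal? p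

  edges : List (Subset n)
  edges = filter edge? (allSubsets n)

  edges-sound : ∀ j → ∣ lookup edges j ∣ ≡ k × Transversal (lookup edges j)
  edges-sound j = proj₂ (∈-filter⁻ edge? {xs = allSubsets n} (∈-lookup j))

  H : KGraph k n
  H = record
    { size     = length edges
    ; edge     = lookup edges
    ; edge-inj = Unique⇒lookup-injective (Unique.filter⁺ edge? (allSubsets-unique n))
    ; uniform  = proj₁ ∘ edges-sound
    }

  open Shadow H

  -- Colour each vertex by the part of its image. The ends of an edge have distinct images in a
  -- common transversal, hence in different parts.
  BergeCopy⇒Colorable : ∀ G → BergeCopy G H → Colorable G r
  BergeCopy⇒Colorable G (i , i-inj , f , _ , covers) = part ∘ i , λ j eq → loopless G j
    (i-inj (proj₂ (edges-sound (f j)) _ _ (proj₁ (covers j)) (proj₂ (covers j)) eq))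

  part≢⇒adj : ∀ u v → part u ≢ part v → adj u v ≡ true
  part≢⇒adj u v pu≢pv = cong₂ (λ a b → not a ∧ b) (dec-false (u Fin.≟ v) (pu≢pv ∘ cong part))
    (dec-true (covered? u v) cov)
    where
    cov : ∃ (Covers u v)
    cov with through u v pu≢pv
    ... | p , tp , |p| , u∈ , v∈ = Any.index p∈ ,
        subst (u Subset.∈_) (lookup-index p∈) u∈ , subst (v Subset.∈_) (lookup-index p∈) v∈
      where
      p∈ : p ∈ edges
      p∈ = ∈-filter⁺ edge? (∈-allSubsets p) (|p| , tp)

  -- Vertices in different parts are adjacent, so the non-neighbours of `u` lie in its own part,
  -- which `combine (part u)` enumerates.
  nn≤M : ∀ u → nn u (allFin n) ≤ M
  nn≤M u = begin
    nn u (allFin n)                                    ≤⟨ ∑-mono (allFin n) (λ {v} _ → bound v) ⟩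
    ∑ (allFin n) (λ v → ind (does (same? v)))          ≡⟨ length-filter same? (allFin n) ⟨
    length (filter same? (allFin n))                   ≤⟨ Unique-⊆-length (Unique.filter⁺ same? (Unique.allFin⁺ n)) fibre ⟩
    length (map (combine (part u)) (allFin M))         ≡⟨ trans (length-map (combine (part u)) (allFin M)) (length-allFin M) ⟩
    M                                                  ∎
    where
    open ≤-Reasoning
    same? : Decidable (λ v → part u ≡ part v)
    same? v = part u Fin.≟ part v
    bound : ∀ v → ind (not (adj u v)) ≤ ind (does (same? v))
    bound v with part u Fin.≟ part v
    ... | no pu≢pv rewrite part≢⇒adj u v pu≢pv = z≤n
    ... | yes _ with adj u v
    ...   | true  = z≤n
    ...   | false = ≤-refl
    fibre : ∀ {v} → v ∈ filter same? (allFin n) → v ∈ map (combine (part u)) (allFin M)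
    fibre {v} v∈ = subst (_∈ map (combine (part u)) (allFin M))
      (trans (cong (λ c → combine c (remainder {r} M v)) (proj₂ (∈-filter⁻ same? {xs = allFin n} v∈))) (Fin.combine-remQuot {r} M v))
      (∈-map⁺ (combine (part u)) (∈-allFin (remainder {r} M v)))

  -- This says S ≥ (1 − 1/r) C(n,2), with denominators cleared.
  shadow-lower : r * (n C 2) ≤ r * shadowSize H + n C 2
  shadow-lower = *-cancelˡ-≤ 2 (+-cancelʳ-≤ (r * n) _ _ (begin
    2 * (r * c) + r * n                      ≡⟨ lem₁ r c n ⟩
    r * (2 * c + n)                          ≡⟨ cong (r *_) (trans (2*nC2+n≡n*n n) (sym shadow+NN)) ⟩
    -- Each vertex misses at most `M` vertices and `r * M = n`, so the missing pairs cost at most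
    -- `n * n` after multiplication by `r`.
    r * (S + S + NN (allFin n))              ≤⟨ *-monoʳ-≤ r (+-monoʳ-≤ (S + S) NN≤) ⟩
    r * (S + S + n * M)                      ≡⟨ lem₂ r S n M ⟩
    2 * (r * S) + n * (r * M)                ≡⟨ cong (2 * (r * S) +_) (2*nC2+n≡n*n n) ⟨
    2 * (r * S) + (2 * c + n)                ≤⟨ +-monoʳ-≤ (2 * (r * S)) (+-monoʳ-≤ (2 * c) (m≤n*m n r {{r≢0}})) ⟩
    2 * (r * S) + (2 * c + r * n)            ≡⟨ lem₃ (r * S) c (r * n) ⟩
    2 * (r * S + c) + r * n                  ∎))
    where
    open ≤-Reasoning
    S = shadowSize H
    c = n C 2
    r≢0 : NonZero r
    r≢0 = >-nonZero (≤-trans (s≤s z≤n) (≤-trans 2≤k k≤r))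
    NN≤ : NN (allFin n) ≤ n * M
    NN≤ = ≤-trans (∑-mono (allFin n) (λ {u} _ → nn≤M u))
      (≤-reflexive (trans (∑-const (allFin n) M) (cong (_* M) (length-allFin n))))
    lem₁ : ∀ r c n → 2 * (r * c) + r * n ≡ r * (2 * c + n)
    lem₁ = solve-∀
    lem₂ : ∀ r S n M → r * (S + S + n * M) ≡ 2 * (r * S) + n * (r * M)
    lem₂ = solve-∀
    lem₃ : ∀ a c b → 2 * a + (2 * c + b) ≡ 2 * (a + c) + b
    lem₃ = solve-∀

-- Clearing denominators

-- `ℚ` reduces fractions to lowest terms, which blocks computation with variables. Unnormalised
-- fractions keep numerator and denominator, so the facts below become facts about integers.
toℚᵘ-/ : ∀ i d → toℚᵘ (i ℚ./ suc d) ℚᵘ.≃ mkℚᵘ i d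
toℚᵘ-/ i d = ℚ.toℚᵘ-fromℚᵘ (mkℚᵘ i d)

ℕtoℚ-mono : ∀ {a b} → a ≤ b → ℕtoℚ a ℚ.≤ ℕtoℚ b
ℕtoℚ-mono {a} {b} a≤b = ℚ.toℚᵘ-cancel-≤ (begin
  toℚᵘ (ℕtoℚ a)    ≃⟨ toℚᵘ-/ (ℤ.+ a) 0 ⟩
  mkℚᵘ (ℤ.+ a) 0     ≤⟨ *≤* (ℤ.*-monoʳ-≤-nonNeg (ℤ.+ 1) (ℤ.+≤+ a≤b)) ⟩
  mkℚᵘ (ℤ.+ b) 0     ≃⟨ toℚᵘ-/ (ℤ.+ b) 0 ⟨
  toℚᵘ (ℕtoℚ b)    ∎)
  where open ℚᵘ.≤-Reasoning

ℕtoℚ-+ : ∀ a b → ℕtoℚ (a + b) ≡ ℕtoℚ a ℚ.+ ℕtoℚ b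
ℕtoℚ-+ a b = ℚ.toℚᵘ-injective (begin
  toℚᵘ (ℕtoℚ (a + b))                  ≈⟨ toℚᵘ-/ (ℤ.+ (a + b)) 0 ⟩
  mkℚᵘ (ℤ.+ (a + b)) 0                   ≈⟨ *≡* (cong (ℤ._* ℤ.+ 1) (cong₂ ℤ._+_ (ℤ.*-identityʳ (ℤ.+ a)) (ℤ.*-identityʳ (ℤ.+ b)))) ⟨
  mkℚᵘ (ℤ.+ a) 0 ℚᵘ.+ mkℚᵘ (ℤ.+ b) 0       ≈⟨ ℚᵘ.+-cong (toℚᵘ-/ (ℤ.+ a) 0) (toℚᵘ-/ (ℤ.+ b) 0) ⟨
  toℚᵘ (ℕtoℚ a) ℚᵘ.+ toℚᵘ (ℕtoℚ b)     ≈⟨ ℚ.toℚᵘ-homo-+ (ℕtoℚ a) (ℕtoℚ b) ⟨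
  toℚᵘ (ℕtoℚ a ℚ.+ ℕtoℚ b)             ∎)
  where open import Relation.Binary.Reasoning.Setoid ℚᵘ.≃-setoid

ℕtoℚ-* : ∀ a b → ℕtoℚ (a * b) ≡ ℕtoℚ a ℚ.* ℕtoℚ b
ℕtoℚ-* a b = ℚ.toℚᵘ-injective (begin
  toℚᵘ (ℕtoℚ (a * b))                  ≈⟨ toℚᵘ-/ (ℤ.+ (a * b)) 0 ⟩
  mkℚᵘ (ℤ.+ (a * b)) 0                   ≈⟨ *≡* (cong (ℤ._* ℤ.+ 1) (ℤ.pos-* a b)) ⟩
  mkℚᵘ (ℤ.+ a) 0 ℚᵘ.* mkℚᵘ (ℤ.+ b) 0       ≈⟨ ℚᵘ.*-cong (toℚᵘ-/ (ℤ.+ a) 0) (toℚᵘ-/ (ℤ.+ b) 0) ⟨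
  toℚᵘ (ℕtoℚ a) ℚᵘ.* toℚᵘ (ℕtoℚ b)     ≈⟨ ℚ.toℚᵘ-homo-* (ℕtoℚ a) (ℕtoℚ b) ⟨
  toℚᵘ (ℕtoℚ a ℚ.* ℕtoℚ b)             ∎)
  where open import Relation.Binary.Reasoning.Setoid ℚᵘ.≃-setoid

inv-*-ℕtoℚ : ∀ d → inv (suc d) ℚ.* ℕtoℚ (suc d) ≡ 1ℚ
inv-*-ℕtoℚ d = ℚ.toℚᵘ-injective (begin
  toℚᵘ (inv (suc d) ℚ.* ℕtoℚ (suc d))               ≈⟨ ℚ.toℚᵘ-homo-* (inv (suc d)) (ℕtoℚ (suc d)) ⟩
  toℚᵘ (inv (suc d)) ℚᵘ.* toℚᵘ (ℕtoℚ (suc d))       ≈⟨ ℚᵘ.*-cong (toℚᵘ-/ (ℤ.+ 1) d) (toℚᵘ-/ (ℤ.+ suc d) 0) ⟩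
  mkℚᵘ (ℤ.+ 1) d ℚᵘ.* mkℚᵘ (ℤ.+ suc d) 0                ≈⟨ *≡* (cong ℤ.+_ (lem d)) ⟩
  toℚᵘ 1ℚ                                           ∎)
  where
  open import Relation.Binary.Reasoning.Setoid ℚᵘ.≃-setoid
  lem : ∀ d → 1 * suc d * 1 ≡ 1 * (suc d * 1)
  lem d = *-assoc 1 (suc d) 1

-- The numerator of a positive rational is at least 1.
inv-denominator≤ : ∀ ε → ℚ.Positive ε → inv (ℚ.denominatorℕ ε) ℚ.≤ ε
inv-denominator≤ (mkℚ +[1+ a ] q _) _ = ℚ.toℚᵘ-cancel-≤ (begin
  toℚᵘ (inv (suc q))     ≃⟨ toℚᵘ-/ (ℤ.+ 1) q ⟩
  mkℚᵘ (ℤ.+ 1) q           ≤⟨ *≤* (ℤ.*-monoʳ-≤-nonNeg (ℤ.+ suc q) (ℤ.+≤+ (s≤s (z≤n {a})))) ⟩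
  mkℚᵘ +[1+ a ] q        ∎)
  where open ℚᵘ.≤-Reasoning

ℕtoℚ-nonNeg : ∀ a → ℚ.NonNegative (ℕtoℚ a)
ℕtoℚ-nonNeg a = ℚ.normalize-nonNeg a 1

clear-upper : ∀ r q S c → suc q * suc r * S + suc q * c ≤ (suc q * suc r + suc r) * c →
  ℕtoℚ S ℚ.≤ (1ℚ ℚ.- inv (suc r) ℚ.+ inv (suc q)) ℚ.* ℕtoℚ c
clear-upper r q S c le = ℚ.*-cancelʳ-≤-pos (ℕtoℚ R) {{ℚ.normalize-pos R 1}} (begin
  s ℚ.* ℕtoℚ R                                    ≡⟨ cong (s ℚ.*_) (ℕtoℚ-* (suc q) (suc r)) ⟩
  s ℚ.* (p ℚ.* t)                                 ≡⟨ lem₁ s p t d ⟩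
  p ℚ.* t ℚ.* s ℚ.+ p ℚ.* d ℚ.- p ℚ.* d           ≤⟨ ℚ.+-monoˡ-≤ (ℚ.- (p ℚ.* d)) le′ ⟩
  (p ℚ.* t ℚ.+ t) ℚ.* d ℚ.- p ℚ.* d               ≡⟨ lem₂ p t d ⟩
  -- The factors `1ℚ` are inserted to be replaced by `j * p` and `i * t`; what remains is a
  -- polynomial identity.
  (p ℚ.* t ℚ.+ t ℚ.* 1ℚ) ℚ.* d ℚ.- p ℚ.* d ℚ.* 1ℚ
    ≡⟨ cong₂ (λ x y → (p ℚ.* t ℚ.+ t ℚ.* x) ℚ.* d ℚ.- p ℚ.* d ℚ.* y) (inv-*-ℕtoℚ q) (inv-*-ℕtoℚ r) ⟨
  (p ℚ.* t ℚ.+ t ℚ.* (j ℚ.* p)) ℚ.* d ℚ.- p ℚ.* d ℚ.* (i ℚ.* t)   ≡⟨ lem₃ p t d i j ⟩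
  (1ℚ ℚ.- i ℚ.+ j) ℚ.* d ℚ.* (p ℚ.* t)            ≡⟨ cong ((1ℚ ℚ.- i ℚ.+ j) ℚ.* d ℚ.*_) (ℕtoℚ-* (suc q) (suc r)) ⟨
  (1ℚ ℚ.- i ℚ.+ j) ℚ.* d ℚ.* ℕtoℚ R               ∎)
  where
  open ℚ.≤-Reasoning
  R = suc q * suc r
  s = ℕtoℚ S
  p = ℕtoℚ (suc q)
  t = ℕtoℚ (suc r)
  d = ℕtoℚ c
  i = inv (suc r)
  j = inv (suc q)
  le′ : p ℚ.* t ℚ.* s ℚ.+ p ℚ.* d ℚ.≤ (p ℚ.* t ℚ.+ t) ℚ.* d
  le′ = subst₂ ℚ._≤_
    (trans (ℕtoℚ-+ (R * S) _) (cong₂ ℚ._+_ (trans (ℕtoℚ-* R S) (cong (ℚ._* s) (ℕtoℚ-* (suc q) (suc r)))) (ℕtoℚ-* (suc q) c)))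
    (trans (ℕtoℚ-* (R + suc r) c) (cong (ℚ._* d) (trans (ℕtoℚ-+ R (suc r)) (cong (ℚ._+ t) (ℕtoℚ-* (suc q) (suc r))))))
    (ℕtoℚ-mono le)
  open +-*-Solver
  lem₁ : ∀ s p t d → s ℚ.* (p ℚ.* t) ≡ p ℚ.* t ℚ.* s ℚ.+ p ℚ.* d ℚ.- p ℚ.* d
  lem₁ = solve 4 (λ s p t d → s :* (p :* t) := p :* t :* s :+ p :* d :- p :* d) refl
  lem₂ : ∀ p t d → (p ℚ.* t ℚ.+ t) ℚ.* d ℚ.- p ℚ.* d ≡ (p ℚ.* t ℚ.+ t ℚ.* 1ℚ) ℚ.* d ℚ.- p ℚ.* d ℚ.* 1ℚ
  lem₂ = solve 3 (λ p t d → (p :* t :+ t) :* d :- p :* d := (p :* t :+ t :* con 1ℚ) :* d :- p :* d :* con 1ℚ) refl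
  lem₃ : ∀ p t d i j → (p ℚ.* t ℚ.+ t ℚ.* (j ℚ.* p)) ℚ.* d ℚ.- p ℚ.* d ℚ.* (i ℚ.* t)
    ≡ (1ℚ ℚ.- i ℚ.+ j) ℚ.* d ℚ.* (p ℚ.* t)
  lem₃ = solve 5 (λ p t d i j → (p :* t :+ t :* (j :* p)) :* d :- p :* d :* (i :* t)
    := (con 1ℚ :- i :+ j) :* d :* (p :* t)) refl

clear-lower : ∀ r S c → suc r * c ≤ suc r * S + c → (1ℚ ℚ.- inv (suc r)) ℚ.* ℕtoℚ c ℚ.≤ ℕtoℚ S
clear-lower r S c le = ℚ.*-cancelʳ-≤-pos t {{ℚ.normalize-pos (suc r) 1}} (begin
  (1ℚ ℚ.- i) ℚ.* d ℚ.* t             ≡⟨ lem₁ i d t ⟩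
  t ℚ.* d ℚ.- i ℚ.* t ℚ.* d          ≡⟨ cong (λ x → t ℚ.* d ℚ.- x ℚ.* d) (inv-*-ℕtoℚ r) ⟩
  t ℚ.* d ℚ.- 1ℚ ℚ.* d               ≤⟨ ℚ.+-monoˡ-≤ (ℚ.- (1ℚ ℚ.* d)) le′ ⟩
  t ℚ.* s ℚ.+ d ℚ.- 1ℚ ℚ.* d         ≡⟨ lem₂ t s d ⟩
  s ℚ.* t                            ∎)
  where
  open ℚ.≤-Reasoning
  s = ℕtoℚ S
  t = ℕtoℚ (suc r)
  d = ℕtoℚ c
  i = inv (suc r)
  le′ : t ℚ.* d ℚ.≤ t ℚ.* s ℚ.+ d
  le′ = subst₂ ℚ._≤_ (ℕtoℚ-* (suc r) c) (trans (ℕtoℚ-+ (suc r * S) c) (cong (ℚ._+ d) (ℕtoℚ-* (suc r) S))) (ℕtoℚ-mono le)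
  open +-*-Solver
  lem₁ : ∀ i d t → (1ℚ ℚ.- i) ℚ.* d ℚ.* t ≡ t ℚ.* d ℚ.- i ℚ.* t ℚ.* d
  lem₁ = solve 3 (λ i d t → (con 1ℚ :- i) :* d :* t := t :* d :- i :* t :* d) refl
  lem₂ : ∀ t s d → t ℚ.* s ℚ.+ d ℚ.- 1ℚ ℚ.* d ≡ s ℚ.* t
  lem₂ = solve 3 (λ t s d → t :* s :+ d :- con 1ℚ :* d := s :* t) refl

-- The cover Turán density.

coverDensity : ∀ k r′ → let r = 2 + r′ in 2 ≤ k → k ≤ r → ∀ G → Colorable G (suc r) → ¬ Colorable G r →
  CoverDensityIs k G (1ℚ ℚ.- inv r)
coverDensity k r′ 2≤k k≤r G colorable ¬colorable = upper , lower
  where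
  r = 2 + r′
  upper : ∀ ε → ℚ.Positive ε → ∃ λ N → ∀ n → n ≥ N → (H : KGraph k n) → BergeFree G H →
    ℕtoℚ (shadowSize H) ℚ.≤ (1ℚ ℚ.- inv r ℚ.+ ε) ℚ.* ℕtoℚ (n C 2)
  -- The field `q` is the denominator of `ε` minus one, so `inv (suc q)` is at most `ε`.
  upper ε@(mkℚ _ q _) ε>0 = bergeThreshold k G r q , λ n n≥N H free → ℚ.≤-trans
    (clear-upper (suc r′) q (shadowSize H) (n C 2) (shadow-upper k G r′ q colorable n n≥N H free))
    (ℚ.*-monoʳ-≤-nonNeg (ℕtoℚ (n C 2)) {{ℕtoℚ-nonNeg (n C 2)}} (ℚ.+-monoʳ-≤ (1ℚ ℚ.- inv r) (inv-denominator≤ ε ε>0)))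
  lower : ∀ ε → ℚ.Positive ε → ∀ N → ∃ λ n → n ≥ N × Σ (KGraph k n) λ H → BergeFree G H ×
    ((1ℚ ℚ.- inv r ℚ.- ε) ℚ.* ℕtoℚ (n C 2) ℚ.≤ ℕtoℚ (shadowSize H))
  -- Parts of size `suc N` give `n = r * suc N`, which exceeds `N`. The construction attains
  -- `1 - 1/r` without any loss of `ε`.
  lower ε ε>0 N = n , ≤-trans (n≤1+n N) (m≤m+n (suc N) _) , H , ¬colorable ∘ BergeCopy⇒Colorable G , ℚ.≤-trans
    (ℚ.*-monoʳ-≤-nonNeg (ℕtoℚ (n C 2)) {{ℕtoℚ-nonNeg (n C 2)}} less)
    (clear-lower (suc r′) (shadowSize H) (n C 2) shadow-lower)
    where
    open Transversals k r N 2≤k k≤r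
    less : 1ℚ ℚ.- inv r ℚ.- ε ℚ.≤ 1ℚ ℚ.- inv r
    less = subst (1ℚ ℚ.- inv r ℚ.- ε ℚ.≤_) (ℚ.+-identityʳ (1ℚ ℚ.- inv r))
      (ℚ.+-monoʳ-≤ (1ℚ ℚ.- inv r) (ℚ.neg-antimono-≤ (ℚ.<⇒≤ (ℚ.positive⁻¹ ε {{ε>0}}))))

theorem2 : (k : ℕ) → k ≥ 2 → (G : Graph) → (χ : ℕ) → IsChromaticNumber G χ → χ ≥ k + 1 →
    CoverDensityIs k G (1ℚ - inv (χ ∸ 1))
theorem2 k k≥2 G χ isχ χ≥k+1 with subst (_≤ χ) (+-comm k 1) χ≥k+1
-- From `2 ≤ k` and `1 + k ≤ χ` it follows that `χ = 3 + r′`. Thus `r = χ - 1 = 2 + r′` satisfies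
-- `k ≤ r`, and minimality of `χ` rules out an `r`-colouring.
theorem2 k k≥2@(s≤s (s≤s _)) G (suc (suc (suc r′))) (colorable , minimal) _ | s≤s k≤r@(s≤s (s≤s _)) =
  coverDensity k r′ k≥2 k≤r G colorable (minimal (2 + r′) ≤-refl)
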